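{- Let $G=(V,E)$ be a control flow graph and $n\in V$. After the procedure $\mathrm{COMPUTE}(n)$ finishes, for each node $m\in V$ it holds that $m$ is red if and only if all maximal paths from $m$ contain $n$.
   Context: A control flow graph (CFG) is a finite directed graph $G=(V,E)$ in which every node has at most two outgoing edges. A path from $n_1$ is a nonempty finite or infinite sequence $n_1n_2\ldots$ of nodes with $(n_i,n_{i+1})\in E$ for all adjacent pairs; it is maximal if it is infinite or its last node has no outgoing edge. The procedure $\mathrm{COMPUTE}(n)$ works as follows: first every node $m\in V$ is marked uncolored and is given a counter initialized to the number of successors of $m$; then $n$ is colored red; then $\mathrm{VISIT}(m)$ is called for every predecessor $m$ of $n$. The recursive procedure $\mathrm{VISIT}(m)$ decrements the counter of $m$ by one, and if the counter becomes $0$, it colors $m$ red and calls $\mathrm{VISIT}(m')$ for every predecessor $m'$ of $m$.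
   Formalization: VISIT(m) is taken to color m and visit its predecessors only if the counter becomes 0 and m is not already red; without this the claim fails, e.g. for edges n→x, x→n, p→n, p→q, where p may turn red although the maximal path p q avoids n. -}

module Defs where

open import Data.Empty using (⊥-elim)
open import Data.Fin using (Fin; zero; suc; inject₁; fromℕ)
open import Data.Fin.Subset using (Subset; _∈_; _∉_; _⊆_; ⁅_⁆; _∪_; ∣_∣)
open import Data.Fin.Subset.Properties
  using (_∈?_; x∈⁅x⁆; p⊆p∪q; q⊆p∪q; ∣p∣≤n; p⊂q⇒∣p∣<∣q∣; p⊆q⇒∣p∣≤∣q∣)
open import Data.Integer using (ℤ; +_; 0ℤ; pred; _≟_)
open import Data.List using (List; []; _∷_; allFin; filter)
open import Data.List.Relation.Binary.Permutation.Propositional using (_↭_; ↭-refl)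
open import Data.Nat using (ℕ; zero; suc; _+_; _≤_)
open import Data.Nat.Properties
  using (≤-trans; <⇒≱; +-monoʳ-≤; +-suc; m≤m+n; module ≤-Reasoning)
open import Data.Product using (∃; ∃-syntax; _×_; _,_)
open import Data.Unit using (⊤)
open import Data.Vec.Functional using (Vector; head; last; updateAt)
open import Function using (_∘_)
open import Relation.Binary.PropositionalEquality using (_≡_)
open import Relation.Nullary using (¬_; yes; no)

record CFG : Set where
  field
    size        : ℕ
    successors  : Fin size → Subset size
    outdegree≤2 : ∀ v → ∣ successors v ∣ ≤ 2

  Node : Set
  Node = Fin size

  infix 4 _⟶_
  _⟶_ : Node → Node → Set
  u ⟶ v = v ∈ successors u

  predecessors : Node → List Node
  predecessors v = filter (λ u → v ∈? successors u) (allFin size)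

module Paths (G : CFG) where
  open CFG G

  data Path : Set where
    finite   : (k : ℕ) (p : Vector Node (suc k)) →
               (∀ (i : Fin k) → p (inject₁ i) ⟶ p (suc i)) → Path
    infinite : (p : ℕ → Node) → (∀ i → p i ⟶ p (suc i)) → Path

  start : Path → Node
  start (finite _ p _) = head p
  start (infinite p _) = p 0

  Maximal : Path → Set
  Maximal (finite _ p _) = ¬ (∃[ v ] last p ⟶ v)
  Maximal (infinite _ _) = ⊤

  infix 4 _Contains_
  _Contains_ : Path → Node → Set
  finite _ p _ Contains n = ∃[ i ] p i ≡ n
  infinite p _ Contains n = ∃[ i ] p i ≡ n

module Algorithm (G : CFG) where
  open CFG G

  -- A colouring is given by its set of red nodes; all others are uncolored.
  record State : Set where
    constructor state
    field
      red     : Subset size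
      counter : Vector ℤ size
  open State public

  initial : Node → State
  initial n = state ⁅ n ⁆ (λ m → + ∣ successors m ∣)

  decrement : Node → State → State
  decrement m (state r c) = state r (updateAt c m pred)

  colourRed : Node → State → State
  colourRed m (state r c) = state (r ∪ ⁅ m ⁆) c

  -- VISIT reacts to a counter reaching 0 only if the node is not red yet.
  -- This matters for the node n on which COMPUTE starts: it is red from the
  -- outset, but its counter may still reach 0.  If VISIT(n) then visited the
  -- predecessors of n a second time, edges into n would be counted twice: with
  -- edges n → x, x → n, p → n, p → q, the node p would become red although the
  -- maximal path p q avoids n.
  Fires : Node → State → Set
  Fires m s = counter s m ≡ 0ℤ × m ∉ red s

  -- Big-step semantics: Visit m s s′ means that VISIT(m) called in state s
  -- finishes in state s′.  Predecessors may be traversed in any order.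
  mutual
    data Visit (m : Node) (s : State) : State → Set where
      stop   : ¬ Fires m (decrement m s) → Visit m s (decrement m s)
      spread : ∀ {ms s′} → Fires m (decrement m s) → ms ↭ predecessors m →
               VisitAll ms (colourRed m (decrement m s)) s′ → Visit m s s′

    data VisitAll : List Node → State → State → Set where
      []  : ∀ {s} → VisitAll [] s s
      _∷_ : ∀ {m ms s s′ s″} →
            Visit m s s′ → VisitAll ms s′ s″ → VisitAll (m ∷ ms) s s″

  Compute : Node → State → Set
  Compute n s = ∃[ ms ] ms ↭ predecessors n × VisitAll ms (initial n) s

  -- The remainder shows that COMPUTE does finish: the number of red nodes grows
  -- whenever VISIT recurses.
  mutual
    visit-⊆ : ∀ {m s s′} → Visit m s s′ → red s ⊆ red s′
    visit-⊆     (stop _)        x∈r = x∈r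
    visit-⊆ {m} (spread _ _ vs) x∈r = visitAll-⊆ vs (p⊆p∪q ⁅ m ⁆ x∈r)

    visitAll-⊆ : ∀ {ms s s′} → VisitAll ms s s′ → red s ⊆ red s′
    visitAll-⊆ []       x∈r = x∈r
    visitAll-⊆ (v ∷ vs) x∈r = visitAll-⊆ vs (visit-⊆ v x∈r)

  red-grows : ∀ m s → m ∉ red s → suc ∣ red s ∣ ≤ ∣ red (colourRed m s) ∣
  red-grows m s m∉r =
    p⊂q⇒∣p∣<∣q∣ (p⊆p∪q ⁅ m ⁆ , m , q⊆p∪q (red s) ⁅ m ⁆ (x∈⁅x⁆ m) , m∉r)

  mutual
    visit-finishes : ∀ k m s → size ≤ k + ∣ red s ∣ → ∃ (Visit m s)
    visit-finishes k m s le
      with counter (decrement m s) m ≟ 0ℤ | m ∈? red s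
    ... | no  c≢0 | _       = _ , stop (λ (c≡0 , _) → c≢0 c≡0)
    ... | yes _   | yes m∈r = _ , stop (λ (_ , m∉r) → m∉r m∈r)
    visit-finishes zero m s le | yes _ | no m∉r =
      ⊥-elim (<⇒≱ (≤-trans (red-grows m s m∉r) (∣p∣≤n (red (colourRed m s)))) le)
    visit-finishes (suc k) m s le | yes c≡0 | no m∉r =
      let s′ , vs = visitAll-finishes k (predecessors m) (colourRed m (decrement m s)) le′
      in  s′ , spread (c≡0 , m∉r) ↭-refl vs
      where
      open ≤-Reasoning
      le′ : size ≤ k + ∣ red (colourRed m s) ∣
      le′ = begin
        size                            ≤⟨ le ⟩
        suc k + ∣ red s ∣               ≡⟨ +-suc k _ ⟨
        k + suc ∣ red s ∣               ≤⟨ +-monoʳ-≤ k (red-grows m s m∉r) ⟩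
        k + ∣ red (colourRed m s) ∣     ∎

    visitAll-finishes : ∀ k ms s → size ≤ k + ∣ red s ∣ → ∃ (VisitAll ms s)
    visitAll-finishes k []       s le = s , []
    visitAll-finishes k (m ∷ ms) s le =
      let s′ , v  = visit-finishes k m s le
          s″ , vs = visitAll-finishes k ms s′
                      (≤-trans le (+-monoʳ-≤ k (p⊆q⇒∣p∣≤∣q∣ (visit-⊆ v))))
      in  s″ , v ∷ vs

  compute-finishes : ∀ n → ∃ (Compute n)
  compute-finishes n =
    let s , vs = visitAll-finishes size (predecessors n) (initial n) (m≤m+n size _)
    in  s , predecessors n , ↭-refl , vs

{-# OPTIONS --safe #-}

-- Call a node inevitable if it is n, or has a successor and all its successors
-- are inevitable; every maximal path from such a node contains n.  At each moment
-- let ks be the list of the calls VISIT that are still to be made.  For every node x,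
--   counter x + (number of red successors of x) = outdegree of x + (occurrences of x in ks),
-- so when the counter of x reaches 0 all successors of x are red, and red nodes are
-- inevitable.  An uncolored node with counter 0 is a sink, as VISIT would have colored
-- it otherwise; at the end ks is empty, so an uncolored node with a successor has an
-- uncolored successor.  If every maximal path from an uncolored node u contains n,
-- the same holds for every successor of u because u ≠ n; moreover u is not a sink.
-- So uncolored successors can be followed forever, which avoids n.
module Submission where

open import Defs
open import Data.Bool using (true; false; _∧_)
open import Data.Bool.Properties using (∨-identityʳ)
open import Data.Fin using (Fin; zero; suc)
import Data.Fin.Properties as Fin
open import Data.Fin.Subset
  using (Subset; _∈_; _∉_; _⊆_; ⊥; ⁅_⁆; _∪_; _∩_; ∣_∣; inside; outside)
open import Data.Fin.Subset.Properties
  using (_∈?_; ∉⊥; ∣⊥∣≡0; x∈⁅x⁆; x∈⁅y⁆⇒x≡y; p⊆p∪q; q⊆p∪q; x∈p∪q⁻; x∈p∩q⁺; x∈p∩q⁻;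
         p∩q⊆p; p∩q⊆q; p⊂q⇒∣p∣<∣q∣; ⊆-antisym; Empty-unique; ∩-distribˡ-∪; ∩-zeroʳ;
         ∪-identityˡ; ∪-identityʳ)
open import Data.Integer as ℤ using (+_; 0ℤ; pred)
import Data.Integer.Properties as ℤ
open import Algebra.Properties.AbelianGroup ℤ.+-0-abelianGroup using (identityˡ-unique)
open import Data.List using (List; []; _∷_; _++_; allFin; filter; length)
open import Data.List.Membership.Propositional using () renaming (_∈_ to _∈ₗ_; _∉_ to _∉ₗ_)
open import Data.List.Membership.Propositional.Properties using (∈-filter⁺; ∈-filter⁻; ∈-allFin)
open import Data.List.Properties
  using (filter-accept; filter-reject; filter-none; filter-++; length-++)
open import Data.List.Relation.Binary.Permutation.Propositional using (_↭_; ↭-sym)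
open import Data.List.Relation.Binary.Permutation.Propositional.Properties
  using (↭-length; filter-↭; All-resp-↭)
open import Data.List.Relation.Unary.All as All using (All; []; _∷_)
open import Data.List.Relation.Unary.All.Properties using (++⁺; ¬Any⇒All¬)
open import Data.List.Relation.Unary.AllPairs using (_∷_)
open import Data.List.Relation.Unary.Any using (here; there)
open import Data.List.Relation.Unary.Unique.Propositional using (Unique)
open import Data.List.Relation.Unary.Unique.Propositional.Properties using (allFin⁺; filter⁺)
open import Data.Nat as ℕ using (ℕ; zero; suc; _+_)
import Data.Nat.Properties as ℕ
open import Data.Product using (∃; ∃-syntax; _×_; _,_; proj₁; proj₂)
open import Data.Sum using (inj₁; inj₂)
open import Data.Unit using (tt)
open import Data.Vec using (_∷_) renaming (here to hereᵥ; there to thereᵥ)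
import Data.Vec.Functional as Vector
open import Data.Vec.Functional.Properties using (updateAt-updates; updateAt-minimal)
open import Function using (_∘_)
open import Function.Bundles using (_⇔_; mk⇔)
open import Relation.Binary.PropositionalEquality
  using (_≡_; _≢_; refl; sym; trans; cong; cong₂; subst; module ≡-Reasoning)
open import Relation.Nullary using (¬_; yes; no; contradiction; ¬?; _×-dec_)
open import Relation.Nullary.Decidable using (decidable-stable)

-- Cardinalities of intersections of finite subsets.

∣p∩[q∪⁅x⁆]∣-∈ : ∀ {n} {x : Fin n} {p q : Subset n} → x ∈ p → x ∉ q →
                ∣ p ∩ (q ∪ ⁅ x ⁆) ∣ ≡ suc ∣ p ∩ q ∣
∣p∩[q∪⁅x⁆]∣-∈ {q = inside  ∷ q} hereᵥ x∉q = contradiction hereᵥ x∉q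
∣p∩[q∪⁅x⁆]∣-∈ {p = _ ∷ p} {q = outside ∷ q} hereᵥ _ =
  cong (λ r → suc ∣ p ∩ r ∣) (∪-identityʳ q)
-- Here `⁅ x ⁆` is `outside` at the head, so both intersections have head `a ∧ b` and both counts
-- gain the same amount from it.
∣p∩[q∪⁅x⁆]∣-∈ {p = a ∷ p} {q = b ∷ q} (thereᵥ x∈p) x∉q
  rewrite ∨-identityʳ b with a ∧ b
... | true  = cong suc (∣p∩[q∪⁅x⁆]∣-∈ x∈p (x∉q ∘ thereᵥ))
... | false = ∣p∩[q∪⁅x⁆]∣-∈ x∈p (x∉q ∘ thereᵥ)

p∩[q∪⁅x⁆]-∉ : ∀ {n} {x : Fin n} {p q : Subset n} → x ∉ p → p ∩ (q ∪ ⁅ x ⁆) ≡ p ∩ q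
p∩[q∪⁅x⁆]-∉ {x = x} {p} {q} x∉p = begin
  p ∩ (q ∪ ⁅ x ⁆)         ≡⟨ ∩-distribˡ-∪ p q ⁅ x ⁆ ⟩
  (p ∩ q) ∪ (p ∩ ⁅ x ⁆)   ≡⟨ cong ((p ∩ q) ∪_) (Empty-unique disjoint) ⟩
  (p ∩ q) ∪ _             ≡⟨ ∪-identityʳ (p ∩ q) ⟩
  p ∩ q                   ∎
  where
  open ≡-Reasoning
  disjoint : ¬ (∃[ y ] y ∈ p ∩ ⁅ x ⁆)
  disjoint (y , y∈) with y∈p , y∈⁅x⁆ ← x∈p∩q⁻ p ⁅ x ⁆ y∈ =
    x∉p (subst (_∈ p) (x∈⁅y⁆⇒x≡y x y∈⁅x⁆) y∈p)

p⊆q⇒p∩q≡p : ∀ {n} {p q : Subset n} → p ⊆ q → p ∩ q ≡ p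
p⊆q⇒p∩q≡p {p = p} {q} p⊆q = ⊆-antisym (p∩q⊆p p q) (λ x∈p → x∈p∩q⁺ (x∈p , p⊆q x∈p))

-- A point of `p` outside `q` would make `p ∩ q` a strict subset of `p`, hence smaller.
∣p∣≤∣p∩q∣⇒p⊆q : ∀ {n} {p q : Subset n} → ∣ p ∣ ℕ.≤ ∣ p ∩ q ∣ → p ⊆ q
∣p∣≤∣p∩q∣⇒p⊆q {p = p} {q} le {x} x∈p = decidable-stable (x ∈? q) λ x∉q →
  ℕ.<⇒≱ (p⊂q⇒∣p∣<∣q∣ (p∩q⊆p p q , x , x∈p , x∉q ∘ p∩q⊆q p q)) le

∣p∣≡0⇒x∉p : ∀ {n} {p : Subset n} {x} → ∣ p ∣ ≡ 0 → x ∉ p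
∣p∣≡0⇒x∉p {p = p} ∣p∣≡0 =
  ∉⊥ ∘ ∣p∣≤∣p∩q∣⇒p⊆q {q = ⊥} (ℕ.≤-trans (ℕ.≤-reflexive ∣p∣≡0) ℕ.z≤n)

-- Multiplicities in lists.

occurrences : ∀ {n} → Fin n → List (Fin n) → ℕ
occurrences x xs = length (filter (x Fin.≟_) xs)

module _ {n} (x : Fin n) where

  occurrences-here : ∀ xs → occurrences x (x ∷ xs) ≡ suc (occurrences x xs)
  occurrences-here xs = cong length (filter-accept (x Fin.≟_) refl)

  occurrences-there : ∀ {y} xs → x ≢ y → occurrences x (y ∷ xs) ≡ occurrences x xs
  occurrences-there xs x≢y = cong length (filter-reject (x Fin.≟_) x≢y)

  occurrences-++ : ∀ xs ys → occurrences x (xs ++ ys) ≡ occurrences x xs + occurrences x ys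
  occurrences-++ xs ys =
    trans (cong length (filter-++ (x Fin.≟_) xs ys)) (length-++ (filter (x Fin.≟_) xs))

  occurrences-↭ : ∀ {xs ys} → xs ↭ ys → occurrences x xs ≡ occurrences x ys
  occurrences-↭ = ↭-length ∘ filter-↭ (x Fin.≟_)

  occurrences-∉ : ∀ {xs} → x ∉ₗ xs → occurrences x xs ≡ 0
  occurrences-∉ = cong length ∘ filter-none (x Fin.≟_) ∘ ¬Any⇒All¬ _

  occurrences-∈ : ∀ {xs} → Unique xs → x ∈ₗ xs → occurrences x xs ≡ 1
  occurrences-∈ {_ ∷ xs} (x≢xs ∷ _) (here refl) =
    trans (occurrences-here xs) (cong suc (cong length (filter-none (x Fin.≟_) x≢xs)))
  occurrences-∈ {_ ∷ xs} (y≢xs ∷ u) (there x∈xs) =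
    trans (occurrences-there xs (All.lookup y≢xs x∈xs ∘ sym)) (occurrences-∈ u x∈xs)

module _ (G : CFG) where
  open CFG G
  open Paths G
  open Algorithm G

  -- Predecessor lists and successor sets.

  ∈-predecessors⁺ : ∀ {u v} → u ⟶ v → u ∈ₗ predecessors v
  ∈-predecessors⁺ = ∈-filter⁺ (λ u → _ ∈? successors u) (∈-allFin _)

  ∈-predecessors⁻ : ∀ {u v} → u ∈ₗ predecessors v → u ⟶ v
  ∈-predecessors⁻ u∈ = proj₂ (∈-filter⁻ (λ u → _ ∈? successors u) {xs = allFin size} u∈)

  -- The list of predecessors is duplicate-free, so `x` occurs in it once or never, according to
  -- whether `m` is a successor of `x`.
  ∣successors∩[r∪⁅m⁆]∣ : ∀ {m r} x → m ∉ r →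
    ∣ successors x ∩ (r ∪ ⁅ m ⁆) ∣ ≡ occurrences x (predecessors m) + ∣ successors x ∩ r ∣
  ∣successors∩[r∪⁅m⁆]∣ {m} x m∉r with m ∈? successors x
  ... | yes x⟶m = trans (∣p∩[q∪⁅x⁆]∣-∈ x⟶m m∉r)
    (cong (_+ _) (sym (occurrences-∈ x (filter⁺ (λ u → m ∈? successors u) (allFin⁺ size))
                                       (∈-predecessors⁺ x⟶m))))
  ... | no x⟶̸m = trans (cong ∣_∣ (p∩[q∪⁅x⁆]-∉ x⟶̸m))
    (cong (_+ _) (sym (occurrences-∉ x (x⟶̸m ∘ ∈-predecessors⁻))))

  -- Nodes whose maximal paths all meet the target.

  -- Being inductive, it admits no justification that runs around a cycle avoiding `n`. The
  -- successor demanded by `onwards` rules out sinks, where the second premise is vacuous.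
  data Inevitable (n : Node) : Node → Set where
    arrived : Inevitable n n
    onwards : ∀ {m} → ∃ (m ⟶_) → (∀ {v} → m ⟶ v → Inevitable n v) → Inevitable n m

  Unavoidable : Node → Node → Set
  Unavoidable n m = (π : Path) → start π ≡ m → Maximal π → π Contains n

  -- Induction on the derivation, dropping the first node of the path each time; this also
  -- terminates on infinite paths.
  inevitable⇒unavoidable : ∀ {n m} → Inevitable n m → Unavoidable n m
  inevitable⇒unavoidable arrived (finite _ _ _) eq _ = zero , eq
  inevitable⇒unavoidable arrived (infinite _ _) eq _ = 0 , eq
  inevitable⇒unavoidable (onwards m⟶ _) (finite zero p _) refl max = contradiction m⟶ max
  inevitable⇒unavoidable (onwards _ next) (finite (suc k) p step) refl max =
    let i , eq = inevitable⇒unavoidable (next (step zero))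
                   (finite k (p ∘ suc) (step ∘ suc)) refl max
    in suc i , eq
  inevitable⇒unavoidable (onwards _ next) (infinite p step) refl _ =
    let i , eq = inevitable⇒unavoidable (next (step 0)) (infinite (p ∘ suc) (step ∘ suc)) refl tt
    in suc i , eq

  -- Prepending `u` to a maximal path from `v` gives a maximal path from `u`; it meets `n`, but not
  -- at index 0.
  unavoidable-step : ∀ {n u v} → u ≢ n → u ⟶ v → Unavoidable n u → Unavoidable n v
  unavoidable-step {u = u} u≢n u⟶v un (finite k p step) refl max
    with un (finite (suc k) (u Vector.∷ p) λ { zero → u⟶v ; (suc i) → step i }) refl max
  ... | zero  , eq = contradiction eq u≢n
  ... | suc i , eq = i , eq
  unavoidable-step {u = u} u≢n u⟶v un (infinite p step) refl max
    with un (infinite (λ { zero → u ; (suc i) → p i }) λ { zero → u⟶v ; (suc i) → step i }) refl max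
  ... | zero  , eq = contradiction eq u≢n
  ... | suc i , eq = i , eq

  -- At a sink `u`, the path consisting of `u` alone is maximal, and it meets `n` only if `u` is
  -- `n`.
  unavoidable⇒successor : ∀ {n u} → u ≢ n → Unavoidable n u → ∃ (u ⟶_)
  unavoidable⇒successor {u = u} u≢n un = decidable-stable (Fin.any? (_∈? successors u)) λ sink →
    u≢n (proj₂ (un (finite 0 (λ _ → u) λ ()) refl sink))

  -- From a node outside `r`, iterating `escape` yields an infinite path that stays outside `r` and
  -- so misses `n`. Unavoidability is carried along because it provides the successor that `escape`
  -- asks for.
  unavoidable⇒∈ : ∀ {n} {r : Subset size} → n ∈ r →
    (∀ {u} → u ∉ r → ∃ (u ⟶_) → ∃[ v ] u ⟶ v × v ∉ r) →
    ∀ {m} → Unavoidable n m → m ∈ r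
  unavoidable⇒∈ {n} {r} n∈r escape {m} un = decidable-stable (m ∈? r) λ m∉r →
    let walk = iterate (m , m∉r , un)
        i , eq = un (infinite (proj₁ ∘ walk) (λ i → proj₂ (advance (walk i)))) refl tt
    in proj₁ (proj₂ (walk i)) (subst (_∈ r) (sym eq) n∈r)
    where
    Outside : Set
    Outside = ∃[ u ] u ∉ r × Unavoidable n u

    advance : (o : Outside) → ∃ λ (o′ : Outside) → proj₁ o ⟶ proj₁ o′
    advance (u , u∉r , un) =
      let u≢n = λ u≡n → u∉r (subst (_∈ r) (sym u≡n) n∈r)
          v , u⟶v , v∉r = escape u∉r (unavoidable⇒successor u≢n un)
      in (v , v∉r , unavoidable-step u≢n u⟶v un) , u⟶v

    iterate : Outside → ℕ → Outside
    iterate o zero    = o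
    iterate o (suc i) = proj₁ (advance (iterate o i))

  -- The balance between counters, red successors and pending calls.

  Balanced : State → List Node → Set
  Balanced s ks = ∀ x →
    counter s x ℤ.+ + ∣ successors x ∩ red s ∣ ≡ + (∣ successors x ∣ + occurrences x ks)

  balanced-decrement : ∀ {s m ks} → Balanced s (m ∷ ks) → Balanced (decrement m s) ks
  balanced-decrement {s} {m} {ks} bal x with x Fin.≟ m
  ... | no x≢m = begin
    counter (decrement m s) x ℤ.+ reds
      ≡⟨ cong (ℤ._+ reds) (updateAt-minimal x m (counter s) x≢m) ⟩
    counter s x ℤ.+ reds
      ≡⟨ bal x ⟩
    + (∣ successors x ∣ + occurrences x (m ∷ ks))
      ≡⟨ cong (λ k → + (∣ successors x ∣ + k)) (occurrences-there x ks x≢m) ⟩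
    + (∣ successors x ∣ + occurrences x ks) ∎
    where
    open ≡-Reasoning
    reds = + ∣ successors x ∩ red s ∣
  ... | yes refl = begin
    counter (decrement x s) x ℤ.+ reds
      ≡⟨ cong (ℤ._+ reds) (updateAt-updates x (counter s)) ⟩
    pred (counter s x) ℤ.+ reds
      ≡⟨ ℤ.pred-+ (counter s x) reds ⟩
    pred (counter s x ℤ.+ reds)
      ≡⟨ cong pred (bal x) ⟩
    pred (+ (∣ successors x ∣ + occurrences x (x ∷ ks)))
      ≡⟨ cong (λ k → pred (+ (∣ successors x ∣ + k))) (occurrences-here x ks) ⟩
    pred (+ (∣ successors x ∣ + suc (occurrences x ks)))
      ≡⟨ cong (pred ∘ +_) (ℕ.+-suc ∣ successors x ∣ _) ⟩
    + (∣ successors x ∣ + occurrences x ks) ∎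
    where
    open ≡-Reasoning
    reds = + ∣ successors x ∩ red s ∣

  -- The red successors that `x` gains are matched by the occurrences of `x` among the new calls
  -- `ms`. As `m` was uncolored, nothing is counted twice.
  balanced-colourRed : ∀ {s m ks ms} → m ∉ red s → ms ↭ predecessors m →
    Balanced s ks → Balanced (colourRed m s) (ms ++ ks)
  balanced-colourRed {s} {m} {ks} {ms} m∉r ms↭ bal x = begin
    c ℤ.+ + ∣ successors x ∩ (red s ∪ ⁅ m ⁆) ∣
      ≡⟨ cong (λ k → c ℤ.+ + k) (∣successors∩[r∪⁅m⁆]∣ x m∉r) ⟩
    c ℤ.+ + (occurrences x (predecessors m) + ∣ successors x ∩ red s ∣)
      ≡⟨ cong (λ k → c ℤ.+ + k) (ℕ.+-comm (occurrences x (predecessors m)) _) ⟩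
    c ℤ.+ (+ ∣ successors x ∩ red s ∣ ℤ.+ + occurrences x (predecessors m))
      ≡⟨ ℤ.+-assoc c _ _ ⟨
    c ℤ.+ + ∣ successors x ∩ red s ∣ ℤ.+ + occurrences x (predecessors m)
      ≡⟨ cong₂ ℤ._+_ (bal x) (cong +_ (sym (occurrences-↭ x ms↭))) ⟩
    + (∣ successors x ∣ + occurrences x ks + occurrences x ms)
      ≡⟨ cong +_ (ℕ.+-assoc ∣ successors x ∣ _ _) ⟩
    + (∣ successors x ∣ + (occurrences x ks + occurrences x ms))
      ≡⟨ cong (λ k → + (∣ successors x ∣ + k)) (ℕ.+-comm (occurrences x ks) _) ⟩
    + (∣ successors x ∣ + (occurrences x ms + occurrences x ks))
      ≡⟨ cong (λ k → + (∣ successors x ∣ + k)) (occurrences-++ x ms ks) ⟨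
    + (∣ successors x ∣ + occurrences x (ms ++ ks)) ∎
    where
    open ≡-Reasoning
    c = counter s x

  -- The start of the procedure is treated as coloring `n` in a state with no red node and no
  -- pending call.
  balanced-initial : ∀ {n ms} → ms ↭ predecessors n → Balanced (initial n) (ms ++ [])
  balanced-initial {n} {ms} ms↭ =
    subst (λ r → Balanced (state r (λ m → + ∣ successors m ∣)) (ms ++ [])) (∪-identityˡ ⁅ n ⁆)
      (balanced-colourRed {state ⊥ (λ m → + ∣ successors m ∣)} {ks = []} ∉⊥ ms↭ uncolored)
    where
    uncolored : Balanced (state ⊥ (λ m → + ∣ successors m ∣)) []
    uncolored x = cong (λ k → + (∣ successors x ∣ + k))
                    (trans (cong ∣_∣ (∩-zeroʳ (successors x))) (∣⊥∣≡0 size))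

  -- With counter 0, the balance makes the number of red successors at least the outdegree.
  balanced-exhausted : ∀ {s ks m} → Balanced s ks → counter s m ≡ 0ℤ → successors m ⊆ red s
  balanced-exhausted {s} {ks} {m} bal c≡0 = ∣p∣≤∣p∩q∣⇒p⊆q (begin
    ∣ successors m ∣                      ≤⟨ ℕ.m≤m+n _ _ ⟩
    ∣ successors m ∣ + occurrences m ks   ≡⟨ ℤ.+-injective reds≡ ⟨
    ∣ successors m ∩ red s ∣              ∎)
    where
    open ℕ.≤-Reasoning
    reds≡ : + ∣ successors m ∩ red s ∣ ≡ + (∣ successors m ∣ + occurrences m ks)
    reds≡ = trans (sym (ℤ.+-identityˡ _)) (trans (cong (ℤ._+ _) (sym c≡0)) (bal m))

  -- The invariant of a run.

  -- `pending⟶` supplies the successor that `onwards` needs when a called node turns red.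
  -- `exhausted⇒sink` expresses that no uncolored node was left behind when its counter dropped to
  -- 0.
  record Invariant (n : Node) (s : State) (ks : List Node) : Set where
    field
      balanced       : Balanced s ks
      pending⟶       : All (λ k → ∃ (k ⟶_)) ks
      red⇒inevitable : ∀ {x} → x ∈ red s → Inevitable n x
      exhausted⇒sink : ∀ {x} → x ∉ red s → counter s x ≡ 0ℤ → ∣ successors x ∣ ≡ 0
  open Invariant

  predecessors⟶ : ∀ {m ms} → ms ↭ predecessors m → All (λ k → ∃ (k ⟶_)) ms
  predecessors⟶ ms↭ = All-resp-↭ (↭-sym ms↭) (All.tabulate λ k∈ → _ , ∈-predecessors⁻ k∈)

  invariant-initial : ∀ {n ms} → ms ↭ predecessors n → Invariant n (initial n) (ms ++ [])
  invariant-initial {n} ms↭ = record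
    { balanced       = balanced-initial ms↭
    ; pending⟶       = ++⁺ (predecessors⟶ ms↭) []
    ; red⇒inevitable = λ x∈ → subst (Inevitable n) (sym (x∈⁅y⁆⇒x≡y n x∈)) arrived
    -- Initially the counter is the outdegree itself.
    ; exhausted⇒sink = λ _ → ℤ.+-injective
    }

  invariant-stop : ∀ {n s m ks} → ¬ Fires m (decrement m s) →
    Invariant n s (m ∷ ks) → Invariant n (decrement m s) ks
  invariant-stop {s = s} {m} ¬fires inv = record
    { balanced       = balanced-decrement {s} (balanced inv)
    ; pending⟶       = All.tail (pending⟶ inv)
    ; red⇒inevitable = red⇒inevitable inv
    ; exhausted⇒sink = sink
    }
    where
    sink : ∀ {x} → x ∉ red s → counter (decrement m s) x ≡ 0ℤ → ∣ successors x ∣ ≡ 0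
    sink {x} x∉r c≡0 with x Fin.≟ m
    ... | yes refl = contradiction (c≡0 , x∉r) ¬fires
    ... | no x≢m   = exhausted⇒sink inv x∉r (trans (sym (updateAt-minimal x m (counter s) x≢m)) c≡0)

  invariant-spread : ∀ {n s m ms ks} → Fires m (decrement m s) → ms ↭ predecessors m →
    Invariant n s (m ∷ ks) → Invariant n (colourRed m (decrement m s)) (ms ++ ks)
  invariant-spread {n} {s} {m} {ks = ks} (c≡0 , m∉r) ms↭ inv = record
    { balanced       = balanced-colourRed {decrement m s} m∉r ms↭ decremented
    ; pending⟶       = ++⁺ (predecessors⟶ ms↭) (All.tail (pending⟶ inv))
    ; red⇒inevitable = inevitable
    ; exhausted⇒sink = sink
    }
    where
    decremented : Balanced (decrement m s) ks
    decremented = balanced-decrement {s} (balanced inv)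

    inevitable : ∀ {x} → x ∈ red s ∪ ⁅ m ⁆ → Inevitable n x
    inevitable x∈ with x∈p∪q⁻ (red s) ⁅ m ⁆ x∈
    ... | inj₁ x∈r = red⇒inevitable inv x∈r
    ... | inj₂ x∈⁅m⁆ rewrite x∈⁅y⁆⇒x≡y m x∈⁅m⁆ =
      -- The balance is used before `m` is colored, so its successors are already red and hence
      -- inevitable.
      onwards (All.head (pending⟶ inv))
        (red⇒inevitable inv ∘ balanced-exhausted {decrement m s} {ks} decremented c≡0)

    sink : ∀ {x} → x ∉ red s ∪ ⁅ m ⁆ → counter (decrement m s) x ≡ 0ℤ → ∣ successors x ∣ ≡ 0
    sink {x} x∉ c≡0 with x Fin.≟ m
    ... | yes refl = contradiction (q⊆p∪q (red s) ⁅ x ⁆ (x∈⁅x⁆ x)) x∉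
    ... | no x≢m   = exhausted⇒sink inv (x∉ ∘ p⊆p∪q ⁅ m ⁆)
                       (trans (sym (updateAt-minimal x m (counter s) x≢m)) c≡0)

  mutual
    -- The list `ks` is arbitrary, since it holds the calls left to the enclosing traversals. It
    -- acts as a stack: a spreading call replaces itself by the calls to its predecessors.
    visit-invariant : ∀ {n m s s′ ks} → Visit m s s′ →
      Invariant n s (m ∷ ks) → Invariant n s′ ks
    visit-invariant (stop ¬fires)         inv = invariant-stop ¬fires inv
    visit-invariant (spread fires ms↭ vs) inv =
      visitAll-invariant vs (invariant-spread fires ms↭ inv)

    visitAll-invariant : ∀ {n ms s s′ ks} → VisitAll ms s s′ →
      Invariant n s (ms ++ ks) → Invariant n s′ ks
    visitAll-invariant []       inv = inv
    visitAll-invariant (v ∷ vs) inv = visitAll-invariant vs (visit-invariant v inv)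

  -- The finished run.

  -- If all successors of `u` were red, the balance with no pending call would give counter 0, so
  -- `u` would be a sink.
  uncolored-escapes : ∀ {n s u} → Invariant n s [] →
    u ∉ red s → ∃ (u ⟶_) → ∃[ v ] u ⟶ v × v ∉ red s
  uncolored-escapes {s = s} {u} inv u∉r (v , u⟶v) =
    decidable-stable (Fin.any? λ w → (w ∈? successors u) ×-dec ¬? (w ∈? red s)) λ none →
      let all-red : successors u ⊆ red s
          all-red {w} u⟶w = decidable-stable (w ∈? red s) λ w∉r → none (w , u⟶w , w∉r)
      in ∣p∣≡0⇒x∉p (exhausted⇒sink inv u∉r (counter≡0 all-red)) u⟶v
    where
    counter≡0 : successors u ⊆ red s → counter s u ≡ 0ℤ
    counter≡0 all-red = identityˡ-unique (counter s u) (+ ∣ successors u ∣) (begin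
      counter s u ℤ.+ + ∣ successors u ∣
        ≡⟨ cong (λ p → counter s u ℤ.+ + ∣ p ∣) (p⊆q⇒p∩q≡p all-red) ⟨
      counter s u ℤ.+ + ∣ successors u ∩ red s ∣
        ≡⟨ balanced inv u ⟩
      + (∣ successors u ∣ + 0)
        ≡⟨ cong +_ (ℕ.+-identityʳ _) ⟩
      + ∣ successors u ∣ ∎)
      where open ≡-Reasoning

theorem3p3 : (G : CFG) → let open CFG G in let open Paths G in let open Algorithm G in
    (n : Node) (s : State) → Compute n s →
    (m : Node) → (m ∈ red s) ⇔ ((π : Path) → start π ≡ m → Maximal π → π Contains n)
theorem3p3 G n s (ms , ms↭ , vs) m = mk⇔
  (inevitable⇒unavoidable G ∘ red⇒inevitable)
  -- The node `n` is red from the outset, and red nodes stay red.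
  (unavoidable⇒∈ G (visitAll-⊆ vs (x∈⁅x⁆ n)) (uncolored-escapes G final))
  where
  open Algorithm G using (visitAll-⊆)
  final = visitAll-invariant G vs (invariant-initial G ms↭)
  open Invariant final
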